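{- Let $n\ge1$, $k\in\mathbf{N}$, $\mathbf{A}$ an alphabet of $n$ letters, and $$\mathbf{S}_3^{n,k}=\{XY : X,Y\in\mathbf{A}^*,\ |X|=|Y|\ge k+1,\ d(X,Y)\le k\}.$$ Then $L_{min}(\mathbf{S}_3^{n,k})=2k+1$.
   Context: A word over $\mathbf{A}$ is a finite sequence of letters; $\mathbf{A}^*$ is the set of all words; $|X|$ is the length of $X$. For words $X,Y$ of equal length, $d(X,Y)$ is the Hamming distance (number of positions in which they differ). A subword is a block of consecutive letters. For $\mathbf{S}\subseteq\mathbf{A}^*$, a word is free from $\mathbf{S}$ if none of its subwords belongs to $\mathbf{S}$. A word $X$ free from $\mathbf{S}$ is crucial with respect to $\mathbf{S}$ if for every letter $a\in\mathbf{A}$ the word $Xa$ contains a subword belonging to $\mathbf{S}$. $L_{min}(\mathbf{S})$ is the smallest length of a crucial word with respect to $\mathbf{S}$. -}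

module Defs where

open import Data.Fin.Base using (Fin)
open import Data.Fin.Properties using (inj⇒≟)
open import Data.List.Base using (List; _++_; _∷ʳ_; length; filter; zip)
open import Data.List.Relation.Binary.Infix.Heterogeneous using (Infix)
open import Data.Nat.Base using (ℕ; _+_; _≤_)
open import Data.Product.Base using (_×_; ∃; ∃₂; uncurry)
open import Function.Base using (_∘_)
open import Function.Bundles using (_↔_)
open import Function.Properties.Inverse using (↔⇒↣)
open import Level using (Level; _⊔_)
open import Relation.Binary.Definitions using (DecidableEquality)
open import Relation.Binary.PropositionalEquality.Core using (_≡_)
open import Relation.Nullary.Decidable.Core using (¬?)
open import Relation.Nullary.Negation.Core using (¬_)
open import Relation.Unary using (Pred)

private
  variable
    a s : Level
    A : Set a
    n : ℕ

Word : Set a → Set a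
Word = List

Subword : Word A → Word A → Set _
Subword = Infix _≡_

ContainsFrom : Pred (Word A) s → Pred (Word A) _
ContainsFrom S X = ∃ λ W → Subword W X × S W

FreeFrom : Pred (Word A) s → Pred (Word A) _
FreeFrom S X = ¬ ContainsFrom S X

Crucial : Pred (Word A) s → Pred (Word A) _
Crucial S X = FreeFrom S X × (∀ x → ContainsFrom S (X ∷ʳ x))

-- L_min is only partially defined, since crucial words need not exist;
-- `Lmin[ S ]≡ ℓ` says that it is defined and equal to ℓ.
Lmin[_]≡_ : {A : Set a} → Pred (Word A) s → ℕ → Set (a ⊔ s)
Lmin[ S ]≡ ℓ =
  (∃ λ X → Crucial S X × length X ≡ ℓ) ×
  (∀ X → Crucial S X → ℓ ≤ length X)

-- `zip` truncates to the shorter word, so this is the Hamming distance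
-- only for words of equal length.
hamming : DecidableEquality A → Word A → Word A → ℕ
hamming _≟_ X Y = length (filter (¬? ∘ uncurry _≟_) (zip X Y))

-- The enumeration of the alphabet serves only to decide equality of letters.
S₃ : {A : Set a} → A ↔ Fin n → ℕ → Pred (Word A) a
S₃ A↔Fin k W = ∃₂ λ X Y →
  W ≡ X ++ Y ×
  length X ≡ length Y ×
  k + 1 ≤ length X ×
  hamming (inj⇒≟ (↔⇒↣ A↔Fin)) X Y ≤ k

{-# OPTIONS --safe #-}

-- Every word of S₃ has length at least 2(k+1), so crucial words have length at
-- least 2k+1 and words of length 2k+1 are free.  The word x²ᵏ⁺¹ is crucial:
-- x²ᵏ⁺¹y = xᵏ⁺¹·xᵏy, and as k ≥ 1 the two halves agree in their first letter.
module Submission where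

open import Defs
open import Data.Fin.Base using (Fin; fromℕ<)
open import Data.Fin.Properties using (inj⇒≟)
open import Data.List.Base using (_∷_; _++_; _∷ʳ_; length; replicate; zip)
open import Data.List.Properties
  using (length-++; length-++-comm; length-replicate; length-zipWith;
         length-filter; filter-reject; ++-assoc)
open import Data.List.Relation.Binary.Infix.Heterogeneous.Properties
  using (length-mono; fromPointwise)
open import Data.List.Relation.Binary.Pointwise as Pointwise using ()
open import Data.Nat.Base using (ℕ; zero; suc; _+_; _*_; _⊓_; _≤_; s≤s⁻¹)
open import Data.Nat.Properties
  using (≤-reflexive; *-monoʳ-≤; +-identityʳ; +-comm; m⊓n≤m; n≮n; module ≤-Reasoning)
open import Data.Nat.Tactic.RingSolver using (solve-∀)
open import Data.Product.Base using (_,_; uncurry)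
open import Function.Base using (_∘_)
open import Function.Bundles using (_↔_; Inverse)
open import Function.Properties.Inverse using (↔⇒↣)
open import Level using (Level)
open import Relation.Binary.Definitions using (DecidableEquality)
open import Relation.Binary.PropositionalEquality
  using (_≡_; refl; sym; trans; cong; subst; module ≡-Reasoning)
open import Relation.Nullary.Decidable.Core using (¬?)

private
  variable
    a : Level
    A : Set a
    n k : ℕ

length-∷ʳ : ∀ (X : Word A) x → length (X ∷ʳ x) ≡ suc (length X)
length-∷ʳ X x = length-++-comm X (x ∷ _)

replicate-+ : ∀ m n (x : A) → replicate (m + n) x ≡ replicate m x ++ replicate n x
replicate-+ zero    n x = refl
replicate-+ (suc m) n x = cong (x ∷_) (replicate-+ m n x)

-- Filtering only shortens the zipped list, and zipping truncates to the shorter word, so `X` and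
-- `Y` may differ in length.
hamming≤length : ∀ (_≟_ : DecidableEquality A) X Y → hamming _≟_ X Y ≤ length X
hamming≤length _≟_ X Y = begin
  hamming _≟_ X Y       ≤⟨ length-filter (¬? ∘ uncurry _≟_) (zip X Y) ⟩
  length (zip X Y)      ≡⟨ length-zipWith _,_ X Y ⟩
  length X ⊓ length Y   ≤⟨ m⊓n≤m (length X) (length Y) ⟩
  length X              ∎
  where open ≤-Reasoning

-- For an abstract `_≟_` the test `x ≟ x` does not reduce, so the head pair is discarded by refuting
-- `x ≢ x`.
hamming-∷ : ∀ (_≟_ : DecidableEquality A) x X Y →
            hamming _≟_ (x ∷ X) (x ∷ Y) ≡ hamming _≟_ X Y
hamming-∷ _≟_ x X Y =
  cong length (filter-reject (¬? ∘ uncurry _≟_) {x , x} {zip X Y} (λ x≢x → x≢x refl))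

module _ (A↔Fin : A ↔ Fin n) where

  S₃-length : ∀ {W} → S₃ A↔Fin k W → 2 * (k + 1) ≤ length W
  S₃-length {k = k} (X , Y , refl , |X|≡|Y| , k+1≤|X| , _) = begin
    2 * (k + 1)          ≤⟨ *-monoʳ-≤ 2 k+1≤|X| ⟩
    -- `2 * m` unfolds to `m + (m + 0)`; the trailing zero is removed before one half is exchanged
    -- for the other.
    2 * length X         ≡⟨ cong (length X +_) (trans (+-identityʳ _) |X|≡|Y|) ⟩
    length X + length Y  ≡⟨ length-++ X ⟨
    length (X ++ Y)      ∎
    where open ≤-Reasoning

  -- Serves both directions: applied to a word of length `2 * k + 1` it yields freeness, applied to
  -- a one-letter extension it yields the lower bound. The bound is written with `suc` so that the
  -- added letter can be cancelled.
  containsFrom-S₃-length : ∀ {X} → ContainsFrom (S₃ A↔Fin k) X → suc (2 * k + 1) ≤ length X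
  containsFrom-S₃-length {k = k} {X} (W , W⊆X , W∈S) = begin
    suc (2 * k + 1)  ≡⟨ double k ⟩
    2 * (k + 1)      ≤⟨ S₃-length W∈S ⟩
    length W         ≤⟨ length-mono W⊆X ⟩
    length X         ∎
    where
    open ≤-Reasoning
    double : ∀ k → suc (2 * k + 1) ≡ 2 * (k + 1)
    double = solve-∀

  -- A letter is demanded because over an empty alphabet the extension condition is vacuous and the
  -- empty word is crucial.
  crucial-S₃-length : A → ∀ X → Crucial (S₃ A↔Fin k) X → 2 * k + 1 ≤ length X
  crucial-S₃-length x X (_ , extend) =
    s≤s⁻¹ (subst (_ ≤_) (length-∷ʳ X x) (containsFrom-S₃-length (extend x)))

  replicate-∷ʳ∈S₃ : ∀ x y → 1 ≤ k → S₃ A↔Fin k (replicate (2 * k + 1) x ∷ʳ y)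
  -- Matching on `suc j` exposes the leading `x` of the second half. For `k = 0` that half is `y`
  -- alone, and the claim fails when `y` differs from `x`.
  replicate-∷ʳ∈S₃ {k = k@(suc j)} x y _ =
    replicate (suc k) x , replicate k x ∷ʳ y , split , same-length ,
    ≤-reflexive (trans (+-comm k 1) (sym (length-replicate (suc k)))) , close
    where
    _≟_ = inj⇒≟ (↔⇒↣ A↔Fin)

    halve : ∀ k → 2 * k + 1 ≡ suc k + k
    halve = solve-∀

    split : replicate (2 * k + 1) x ∷ʳ y ≡ replicate (suc k) x ++ (replicate k x ∷ʳ y)
    split = begin
      replicate (2 * k + 1) x ∷ʳ y                      ≡⟨ cong (λ m → replicate m x ∷ʳ y) (halve k) ⟩
      replicate (suc k + k) x ∷ʳ y                      ≡⟨ cong (_∷ʳ y) (replicate-+ (suc k) k x) ⟩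
      (replicate (suc k) x ++ replicate k x) ∷ʳ y       ≡⟨ ++-assoc (replicate (suc k) x) _ _ ⟩
      replicate (suc k) x ++ (replicate k x ∷ʳ y)       ∎
      where open ≡-Reasoning

    same-length : length (replicate (suc k) x) ≡ length (replicate k x ∷ʳ y)
    same-length = sym (length-∷ʳ (replicate k x) y)

    close : hamming _≟_ (replicate (suc k) x) (replicate k x ∷ʳ y) ≤ k
    close = begin
      hamming _≟_ (replicate (suc k) x) (replicate k x ∷ʳ y)  ≡⟨ hamming-∷ _≟_ x (replicate k x) (replicate j x ∷ʳ y) ⟩
      -- The words differ at most in the last letter, but counting all `k` remaining positions is
      -- enough.
      hamming _≟_ (replicate k x) (replicate j x ∷ʳ y)        ≤⟨ hamming≤length _≟_ (replicate k x) (replicate j x ∷ʳ y) ⟩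
      length (replicate k x)                                  ≡⟨ length-replicate k ⟩
      k                                                       ∎
      where open ≤-Reasoning

  replicate-crucial : ∀ x → 1 ≤ k → Crucial (S₃ A↔Fin k) (replicate (2 * k + 1) x)
  replicate-crucial {k = k} x 1≤k =
    (λ c → n≮n _ (subst (_ ≤_) (length-replicate (2 * k + 1)) (containsFrom-S₃-length c))) ,
    -- The forbidden subword is the whole extended word.
    (λ y → _ , fromPointwise (Pointwise.refl refl) , replicate-∷ʳ∈S₃ x y 1≤k)

theorem3 : ∀ {a} (n k : ℕ) → 1 ≤ n → 1 ≤ k →
    (A : Set a) (A↔Fin : A ↔ Fin n) →
    Lmin[ S₃ A↔Fin k ]≡ (2 * k + 1)
theorem3 n k 1≤n 1≤k A A↔Fin =
  (replicate (2 * k + 1) x , replicate-crucial A↔Fin x 1≤k , length-replicate (2 * k + 1)) ,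
  crucial-S₃-length A↔Fin x
  where
  x : A
  -- `1 ≤ n` is `0 < n`, so index 0 names a letter; it is both the letter repeated in the witness
  -- and the one appended for the lower bound.
  x = Inverse.from A↔Fin (fromℕ< 1≤n)
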